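{- Let $(r_k)_{k\in\mathbb{N}_0}$ be a real-valued sequence satisfying $$r_{k+2}=r_1r_{k+1}-r_k\qquad\text{for all }k\ge0,$$ with $r_0,r_1\in\mathbb{R}$. Let $(s_k)_{k\in\mathbb{N}_0}$ be the sequence with initial values $s_0=2$, $s_1=r_1$ satisfying $s_{k+2}=s_1s_{k+1}-s_k$ for all $k\ge0$. Then for all $p\ge0$ and $k\ge0$, $$r_{k+2p}=s_p\,r_{k+p}-r_k.$$
   Context: $\mathbb{N}_0$ denotes the set of non-negative integers; $p$ and $k$ are integers. -}

module Defs where

open import Algebra.Bundles using (CommutativeRing)
open import Data.Integer.Base using (+_)
open import Data.Nat.Base as ℕ using (ℕ)
import Data.Nat.Properties as ℕ
open import Data.Product using (∃; _×_; _,_)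
open import Data.Rational as ℚ using (ℚ; 0ℚ; 1ℚ; ½; ∣_∣; Positive)
import Data.Rational.Properties as ℚ
open import Data.Rational.Solver using (module +-*-Solver)
open import Level using (0ℓ)
open import Relation.Binary.PropositionalEquality
  using (_≡_; refl; sym; trans; cong; cong₂; subst; subst₂)

infix  4 _≃_
infixl 6 _+_ _-_
infixl 7 _*_
infix  8 -_

-- The real numbers, by Cantor's construction: Cauchy sequences of rationals,
-- identified when their difference tends to 0.  There are no quotient types
-- here, so ℝ is a setoid and _≃_ is its equality.

IsCauchy : (ℕ → ℚ) → Set
IsCauchy x = ∀ ε → 0ℚ ℚ.< ε →
  ∃ λ N → ∀ m n → N ℕ.≤ m → N ℕ.≤ n → ∣ x m ℚ.- x n ∣ ℚ.< ε

record ℝ : Set where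
  constructor mkℝ
  field
    seq    : ℕ → ℚ
    cauchy : IsCauchy seq

open ℝ public

_≃_ : ℝ → ℝ → Set
x ≃ y = ∀ ε → 0ℚ ℚ.< ε →
  ∃ λ N → ∀ n → N ℕ.≤ n → ∣ seq x n ℚ.- seq y n ∣ ℚ.< ε

private
  open +-*-Solver using (solve; con; _:=_; _:+_; _:*_; _:-_; :-_)

  ∣p-p∣<ε : ∀ p {ε} → 0ℚ ℚ.< ε → ∣ p ℚ.- p ∣ ℚ.< ε
  ∣p-p∣<ε p 0<ε = subst (λ t → ∣ t ∣ ℚ.< _) (sym (ℚ.+-inverseʳ p)) 0<ε

  0<½ε : ∀ {ε} → 0ℚ ℚ.< ε → 0ℚ ℚ.< ½ ℚ.* ε
  0<½ε {ε} 0<ε = subst (ℚ._< ½ ℚ.* ε) (ℚ.*-zeroʳ ½) (ℚ.*-monoʳ-<-pos ½ 0<ε)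

  ½ε+½ε≡ε : ∀ ε → ½ ℚ.* ε ℚ.+ ½ ℚ.* ε ≡ ε
  ½ε+½ε≡ε = solve 1 (λ e → con ½ :* e :+ con ½ :* e := e) refl

  +-small : ∀ p q {ε} → ∣ p ∣ ℚ.< ½ ℚ.* ε → ∣ q ∣ ℚ.< ½ ℚ.* ε → ∣ p ℚ.+ q ∣ ℚ.< ε
  +-small p q {ε} p< q< = subst (∣ p ℚ.+ q ∣ ℚ.<_) (½ε+½ε≡ε ε)
    (ℚ.≤-<-trans (ℚ.∣p+q∣≤∣p∣+∣q∣ p q) (ℚ.+-mono-< p< q<))

  *-small : ∀ {A ε} → 0ℚ ℚ.< A → 0ℚ ℚ.< ε →
    ∃ λ δ → 0ℚ ℚ.< δ × (∀ p q → ∣ p ∣ ℚ.≤ A → ∣ q ∣ ℚ.< δ → ∣ p ℚ.* q ∣ ℚ.< ε)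
  *-small {A} {ε} 0<A 0<ε = δ , 0<δ , bound
    where
    instance
      A-pos : Positive A
      A-pos = ℚ.positive 0<A
      A-nonZero : ℚ.NonZero A
      A-nonZero = ℚ.pos⇒nonZero A
      1/A-pos : Positive (ℚ.1/ A)
      1/A-pos = ℚ.1/pos⇒pos A
    δ = ℚ.1/ A ℚ.* ε
    0<δ : 0ℚ ℚ.< δ
    0<δ = subst (ℚ._< δ) (ℚ.*-zeroʳ (ℚ.1/ A)) (ℚ.*-monoʳ-<-pos (ℚ.1/ A) 0<ε)
    Aδ≡ε : A ℚ.* δ ≡ ε
    Aδ≡ε = trans (sym (ℚ.*-assoc A (ℚ.1/ A) ε))
      (trans (cong (ℚ._* ε) (ℚ.*-inverseʳ A)) (ℚ.*-identityˡ ε))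
    bound : ∀ p q → ∣ p ∣ ℚ.≤ A → ∣ q ∣ ℚ.< δ → ∣ p ℚ.* q ∣ ℚ.< ε
    bound p q p≤A q<δ = subst₂ ℚ._<_ (sym (ℚ.∣p*q∣≡∣p∣*∣q∣ p q)) Aδ≡ε
      (ℚ.≤-<-trans
        (ℚ.*-monoʳ-≤-nonNeg ∣ q ∣ {{ℚ.∣-∣-nonNeg q}} p≤A)
        (ℚ.*-monoʳ-<-pos A q<δ))

  bounded : ∀ {x} → IsCauchy x →
    ∃ λ A → 0ℚ ℚ.< A × ∃ λ N → ∀ n → N ℕ.≤ n → ∣ x n ∣ ℚ.≤ A
  bounded {x} cx with cx 1ℚ (ℚ.positive⁻¹ 1ℚ)
  ... | N , c = ∣ x N ∣ ℚ.+ 1ℚ , ℚ.+-mono-≤-< (ℚ.0≤∣p∣ (x N)) (ℚ.positive⁻¹ 1ℚ)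
      , N , λ n N≤n → subst (λ t → ∣ t ∣ ℚ.≤ ∣ x N ∣ ℚ.+ 1ℚ) (split (x N) (x n))
          (ℚ.≤-trans (ℚ.∣p+q∣≤∣p∣+∣q∣ (x N) (x n ℚ.- x N))
            (ℚ.+-monoʳ-≤ ∣ x N ∣ (ℚ.<⇒≤ (c n N N≤n ℕ.≤-refl))))
    where
    split : ∀ p q → p ℚ.+ (q ℚ.- p) ≡ q
    split = solve 2 (λ p q → p :+ (q :- p) := q) refl

  +-diff : ∀ a b c d → (a ℚ.- c) ℚ.+ (b ℚ.- d) ≡ (a ℚ.+ b) ℚ.- (c ℚ.+ d)
  +-diff = solve 4 (λ a b c d → (a :- c) :+ (b :- d) := (a :+ b) :- (c :+ d)) refl

  *-diff : ∀ a b c d →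
    a ℚ.* (b ℚ.- d) ℚ.+ d ℚ.* (a ℚ.- c) ≡ (a ℚ.* b) ℚ.- (c ℚ.* d)
  *-diff = solve 4 (λ a b c d →
    a :* (b :- d) :+ d :* (a :- c) := (a :* b) :- (c :* d)) refl

  *-diff-small : ∀ {A B ε} → 0ℚ ℚ.< A → 0ℚ ℚ.< B → 0ℚ ℚ.< ε →
    ∃ λ η → 0ℚ ℚ.< η × ∃ λ δ → 0ℚ ℚ.< δ × (∀ a b c d →
      ∣ a ∣ ℚ.≤ A → ∣ d ∣ ℚ.≤ B → ∣ a ℚ.- c ∣ ℚ.< η → ∣ b ℚ.- d ∣ ℚ.< δ →
      ∣ a ℚ.* b ℚ.- c ℚ.* d ∣ ℚ.< ε)
  *-diff-small {A} {B} {ε} 0<A 0<B 0<ε =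
    let δ , 0<δ , smallA = *-small 0<A (0<½ε 0<ε)
        η , 0<η , smallB = *-small 0<B (0<½ε 0<ε)
    in η , 0<η , δ , 0<δ , λ a b c d a≤A d≤B a-c<η b-d<δ →
      subst (λ t → ∣ t ∣ ℚ.< ε) (*-diff a b c d)
        (+-small (a ℚ.* (b ℚ.- d)) (d ℚ.* (a ℚ.- c))
          (smallA a (b ℚ.- d) a≤A b-d<δ) (smallB d (a ℚ.- c) d≤B a-c<η))

  ∣neg-diff∣ : ∀ a b → ∣ a ℚ.- b ∣ ≡ ∣ (ℚ.- a) ℚ.- (ℚ.- b) ∣
  ∣neg-diff∣ a b = trans (sym (ℚ.∣-p∣≡∣p∣ (a ℚ.- b)))
    (cong ∣_∣ (solve 2 (λ a b → :- (a :- b) := (:- a) :- (:- b)) refl a b))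

  ⊔ˡ : ∀ {m n o} → m ℕ.⊔ n ℕ.≤ o → m ℕ.≤ o
  ⊔ˡ {m} {n} = ℕ.m⊔n≤o⇒m≤o m n

  ⊔ʳ : ∀ {m n o} → m ℕ.⊔ n ℕ.≤ o → n ℕ.≤ o
  ⊔ʳ {m} {n} = ℕ.m⊔n≤o⇒n≤o m n

  ⊔⁴ : ∀ a b c d {n} → (a ℕ.⊔ b) ℕ.⊔ (c ℕ.⊔ d) ℕ.≤ n →
    a ℕ.≤ n × b ℕ.≤ n × c ℕ.≤ n × d ℕ.≤ n
  ⊔⁴ a b c d ≤n =
    let ab = ℕ.m⊔n≤o⇒m≤o (a ℕ.⊔ b) (c ℕ.⊔ d) ≤n
        cd = ℕ.m⊔n≤o⇒n≤o (a ℕ.⊔ b) (c ℕ.⊔ d) ≤n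
    in ℕ.m⊔n≤o⇒m≤o a b ab , ℕ.m⊔n≤o⇒n≤o a b ab
     , ℕ.m⊔n≤o⇒m≤o c d cd , ℕ.m⊔n≤o⇒n≤o c d cd

  +-cauchy : ∀ {x y} → IsCauchy x → IsCauchy y → IsCauchy (λ n → x n ℚ.+ y n)
  +-cauchy {x} {y} cx cy ε 0<ε
    with cx (½ ℚ.* ε) (0<½ε 0<ε) | cy (½ ℚ.* ε) (0<½ε 0<ε)
  ... | M , f | N , g = M ℕ.⊔ N , λ m n ≤m ≤n →
    subst (λ t → ∣ t ∣ ℚ.< ε) (+-diff (x m) (y m) (x n) (y n))
      (+-small (x m ℚ.- x n) (y m ℚ.- y n) (f m n (⊔ˡ ≤m) (⊔ˡ ≤n)) (g m n (⊔ʳ ≤m) (⊔ʳ ≤n)))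

  neg-cauchy : ∀ {x} → IsCauchy x → IsCauchy (λ n → ℚ.- x n)
  neg-cauchy {x} cx ε 0<ε with cx ε 0<ε
  ... | N , f = N , λ m n ≤m ≤n →
    subst (ℚ._< ε) (∣neg-diff∣ (x m) (x n)) (f m n ≤m ≤n)

  *-cauchy : ∀ {x y} → IsCauchy x → IsCauchy y → IsCauchy (λ n → x n ℚ.* y n)
  *-cauchy {x} {y} cx cy ε 0<ε =
    let A , 0<A , M₁ , x≤A = bounded {x} cx
        B , 0<B , N₁ , y≤B = bounded {y} cy
        η , 0<η , δ , 0<δ , small = *-diff-small 0<A 0<B 0<ε
        M₂ , f = cx η 0<η
        N₂ , g = cy δ 0<δ
    in (M₁ ℕ.⊔ M₂) ℕ.⊔ (N₁ ℕ.⊔ N₂) , λ m n ≤m ≤n →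
      let M₁≤m , M₂≤m , _    , N₂≤m = ⊔⁴ M₁ M₂ N₁ N₂ ≤m
          _    , M₂≤n , N₁≤n , N₂≤n = ⊔⁴ M₁ M₂ N₁ N₂ ≤n
      in small (x m) (y m) (x n) (y n)
        (x≤A m M₁≤m) (y≤B n N₁≤n) (f m n M₂≤m M₂≤n) (g m n N₂≤m N₂≤n)

fromℚ : ℚ → ℝ
fromℚ q = mkℝ (λ _ → q) λ ε 0<ε → 0 , λ _ _ _ _ → ∣p-p∣<ε q 0<ε

0ℝ 1ℝ 2ℝ : ℝ
0ℝ = fromℚ 0ℚ
1ℝ = fromℚ 1ℚ
2ℝ = fromℚ (+ 2 ℚ./ 1)

_+_ : ℝ → ℝ → ℝ
x + y = mkℝ (λ n → seq x n ℚ.+ seq y n) (+-cauchy {seq x} {seq y} (cauchy x) (cauchy y))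

-_ : ℝ → ℝ
- x = mkℝ (λ n → ℚ.- seq x n) (neg-cauchy {seq x} (cauchy x))

_-_ : ℝ → ℝ → ℝ
x - y = x + - y

_*_ : ℝ → ℝ → ℝ
x * y = mkℝ (λ n → seq x n ℚ.* seq y n) (*-cauchy {seq x} {seq y} (cauchy x) (cauchy y))

pointwise : ∀ {x y} → (∀ n → seq x n ≡ seq y n) → x ≃ y
pointwise {x} {y} x≡y ε 0<ε = 0 , λ n _ →
  subst (λ t → ∣ seq x n ℚ.- t ∣ ℚ.< ε) (x≡y n) (∣p-p∣<ε (seq x n) 0<ε)

≃-refl : ∀ {x} → x ≃ x
≃-refl {x} = pointwise {x} {x} λ _ → refl

≃-sym : ∀ {x y} → x ≃ y → y ≃ x
≃-sym {x} {y} x≃y ε 0<ε with x≃y ε 0<ε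
... | N , f = N , λ n N≤n →
  subst (ℚ._< ε) (flip (seq x n) (seq y n)) (f n N≤n)
  where
  flip : ∀ a b → ∣ a ℚ.- b ∣ ≡ ∣ b ℚ.- a ∣
  flip a b = trans (sym (ℚ.∣-p∣≡∣p∣ (a ℚ.- b)))
    (cong ∣_∣ (solve 2 (λ a b → :- (a :- b) := b :- a) refl a b))

≃-trans : ∀ {x y z} → x ≃ y → y ≃ z → x ≃ z
≃-trans {x} {y} {z} x≃y y≃z ε 0<ε
  with x≃y (½ ℚ.* ε) (0<½ε 0<ε) | y≃z (½ ℚ.* ε) (0<½ε 0<ε)
... | M , f | N , g = M ℕ.⊔ N , λ n ≤n →
  subst (λ t → ∣ t ∣ ℚ.< ε) (telescope (seq x n) (seq y n) (seq z n))
    (+-small (seq x n ℚ.- seq y n) (seq y n ℚ.- seq z n) (f n (⊔ˡ ≤n)) (g n (⊔ʳ ≤n)))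
  where
  telescope : ∀ a b c → (a ℚ.- b) ℚ.+ (b ℚ.- c) ≡ a ℚ.- c
  telescope = solve 3 (λ a b c → (a :- b) :+ (b :- c) := a :- c) refl

+-cong : ∀ {x x′ y y′} → x ≃ x′ → y ≃ y′ → x + y ≃ x′ + y′
+-cong {x} {x′} {y} {y′} x≃x′ y≃y′ ε 0<ε
  with x≃x′ (½ ℚ.* ε) (0<½ε 0<ε) | y≃y′ (½ ℚ.* ε) (0<½ε 0<ε)
... | M , f | N , g = M ℕ.⊔ N , λ n ≤n →
  subst (λ t → ∣ t ∣ ℚ.< ε) (+-diff (seq x n) (seq y n) (seq x′ n) (seq y′ n))
    (+-small (seq x n ℚ.- seq x′ n) (seq y n ℚ.- seq y′ n) (f n (⊔ˡ ≤n)) (g n (⊔ʳ ≤n)))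

neg-cong : ∀ {x y} → x ≃ y → - x ≃ - y
neg-cong {x} {y} x≃y ε 0<ε with x≃y ε 0<ε
... | N , f = N , λ n N≤n →
  subst (ℚ._< ε) (∣neg-diff∣ (seq x n) (seq y n)) (f n N≤n)

*-cong : ∀ {x x′ y y′} → x ≃ x′ → y ≃ y′ → x * y ≃ x′ * y′
*-cong {x} {x′} {y} {y′} x≃x′ y≃y′ ε 0<ε =
  let A , 0<A , M₁ , x≤A = bounded {seq x} (cauchy x)
      B , 0<B , N₁ , y′≤B = bounded {seq y′} (cauchy y′)
      η , 0<η , δ , 0<δ , small = *-diff-small 0<A 0<B 0<ε
      M₂ , f = x≃x′ η 0<η
      N₂ , g = y≃y′ δ 0<δ
  in (M₁ ℕ.⊔ M₂) ℕ.⊔ (N₁ ℕ.⊔ N₂) , λ n ≤n →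
    let M₁≤n , M₂≤n , N₁≤n , N₂≤n = ⊔⁴ M₁ M₂ N₁ N₂ ≤n
    in small (seq x n) (seq y n) (seq x′ n) (seq y′ n)
      (x≤A n M₁≤n) (y′≤B n N₁≤n) (f n M₂≤n) (g n N₂≤n)

ℝ-commutativeRing : CommutativeRing 0ℓ 0ℓ
ℝ-commutativeRing = record
  { Carrier = ℝ ; _≈_ = _≃_ ; _+_ = _+_ ; _*_ = _*_ ; -_ = -_ ; 0# = 0ℝ ; 1# = 1ℝ
  ; isCommutativeRing = record
    { isRing = record
      { +-isAbelianGroup = record
        { isGroup = record
          { isMonoid = record
            { isSemigroup = record
              { isMagma = record
                { isEquivalence = record
                  { refl  = λ {x} → ≃-refl {x}
                  ; sym   = λ {x} {y} → ≃-sym {x} {y}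
                  ; trans = λ {x} {y} {z} → ≃-trans {x} {y} {z}
                  }
                ; ∙-cong = λ {x} {x′} {y} {y′} → +-cong {x} {x′} {y} {y′}
                }
              ; assoc = λ x y z → pointwise {(x + y) + z} {x + (y + z)}
                  λ n → ℚ.+-assoc (seq x n) (seq y n) (seq z n)
              }
            ; identity =
                (λ x → pointwise {0ℝ + x} {x} λ n → ℚ.+-identityˡ (seq x n))
              , (λ x → pointwise {x + 0ℝ} {x} λ n → ℚ.+-identityʳ (seq x n))
            }
          ; inverse =
              (λ x → pointwise {(- x) + x} {0ℝ} λ n → ℚ.+-inverseˡ (seq x n))
            , (λ x → pointwise {x + - x} {0ℝ} λ n → ℚ.+-inverseʳ (seq x n))
          ; ⁻¹-cong = λ {x} {y} → neg-cong {x} {y}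
          }
        ; comm = λ x y → pointwise {x + y} {y + x} λ n → ℚ.+-comm (seq x n) (seq y n)
        }
      ; *-cong = λ {x} {x′} {y} {y′} → *-cong {x} {x′} {y} {y′}
      ; *-assoc = λ x y z → pointwise {(x * y) * z} {x * (y * z)}
          λ n → ℚ.*-assoc (seq x n) (seq y n) (seq z n)
      ; *-identity =
          (λ x → pointwise {1ℝ * x} {x} λ n → ℚ.*-identityˡ (seq x n))
        , (λ x → pointwise {x * 1ℝ} {x} λ n → ℚ.*-identityʳ (seq x n))
      ; distrib =
          (λ x y z → pointwise {x * (y + z)} {x * y + x * z}
            λ n → ℚ.*-distribˡ-+ (seq x n) (seq y n) (seq z n))
        , (λ x y z → pointwise {(y + z) * x} {y * x + z * x}
            λ n → ℚ.*-distribʳ-+ (seq x n) (seq y n) (seq z n))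
      }
    ; *-comm = λ x y → pointwise {x * y} {y * x} λ n → ℚ.*-comm (seq x n) (seq y n)
    }
  }

-- In the additive form r (k + 2p) + r k ≃ s p * r (k + p), the case p + 2 for k
-- is r 1 times the case p + 1 for k + 1, minus the case p for k + 2: all three
-- have the same middle index k + p + 2.

module Submission where

open import Defs
open import Data.Nat.Base as ℕ using (ℕ; zero; suc)

open import Algebra.Bundles using (CommutativeRing)
import Algebra.Properties.CommutativeSemigroup as CommutativeSemigroupProperties
import Algebra.Properties.Group as GroupProperties
import Data.Nat.Properties as ℕ
open import Data.Nat.Tactic.RingSolver using (solve-∀)
open import Relation.Binary.PropositionalEquality using (_≡_; refl; trans; cong; subst; subst₂)
import Relation.Binary.Reasoning.Setoid as SetoidReasoning

-- Only commutative-ring laws enter the induction, so it runs over any `R`; there `_≈_` stays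
-- opaque, whereas `_≃_` would unfold to an ε-statement about sequences.
module LucasRecurrence {c ℓ} (R : CommutativeRing c ℓ) where
  private module R = CommutativeRing R
  open R using (Carrier; _≈_)
  open CommutativeSemigroupProperties R.+-commutativeSemigroup using (interchange)
  open GroupProperties R.+-group using (∙-cancelʳ; //-rightDividesˡ)
  open SetoidReasoning R.setoid

  -⇒+ : ∀ {x y z} → x ≈ y R.- z → x R.+ z ≈ y
  -⇒+ {x} {y} {z} x≈y-z = R.trans (R.+-congʳ x≈y-z) (//-rightDividesˡ z y)

  Recurrence : Carrier → (ℕ → Carrier) → Set ℓ
  Recurrence a u = ∀ k → u (2 ℕ.+ k) R.+ u k ≈ a R.* u (1 ℕ.+ k)

  module _ {a : Carrier} {r s : ℕ → Carrier}
    (r-rec : Recurrence a r) (s-rec : Recurrence a s)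
    (s₀ : s 0 ≈ R.1# R.+ R.1#) (s₁ : s 1 ≈ a) where

    -- Two-step induction on `p` with `k` varying. The middle index is a variable `m` tied to `p`
    -- and `k` by an equation, so both induction hypotheses speak of the same `r m` without
    -- transport.
    symmetric-sum : ∀ p {k m} → p ℕ.+ k ≡ m → r (p ℕ.+ m) R.+ r k ≈ s p R.* r m
    symmetric-sum zero {k} refl = begin
      r k R.+ r k                          ≈⟨ R.+-cong (R.*-identityˡ (r k)) (R.*-identityˡ (r k)) ⟨
      R.1# R.* r k R.+ R.1# R.* r k        ≈⟨ R.distribʳ (r k) R.1# R.1# ⟨
      (R.1# R.+ R.1#) R.* r k              ≈⟨ R.*-congʳ s₀ ⟨
      s 0 R.* r k                          ∎
    symmetric-sum (suc zero) {k} refl = R.trans (r-rec k) (R.*-congʳ (R.sym s₁))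
    symmetric-sum (suc (suc p)) {k} {m} 2+p+k≡m =
      -- Subtraction is avoided by adding `s p * r m` to both sides: the hypothesis for `p` expands
      -- it on the left, and `s-rec p` produces it again on the right.
      ∙-cancelʳ (s p R.* r m) _ _ (begin
        (r (2 ℕ.+ p ℕ.+ m) R.+ r k) R.+ s p R.* r m
          ≈⟨ R.+-congˡ (symmetric-sum p p+2+k≡m) ⟨
        (r (2 ℕ.+ p ℕ.+ m) R.+ r k) R.+ (r (p ℕ.+ m) R.+ r (2 ℕ.+ k))
          ≈⟨ interchange _ _ _ _ ⟩
        (r (2 ℕ.+ p ℕ.+ m) R.+ r (p ℕ.+ m)) R.+ (r k R.+ r (2 ℕ.+ k))
          -- The regrouped pairs have indices differing by 2, so each is an instance of the
          -- recurrence for `r`.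
          ≈⟨ R.+-cong (r-rec (p ℕ.+ m)) (R.trans (R.+-comm _ _) (r-rec k)) ⟩
        a R.* r (1 ℕ.+ p ℕ.+ m) R.+ a R.* r (1 ℕ.+ k)
          ≈⟨ R.distribˡ a _ _ ⟨
        a R.* (r (1 ℕ.+ p ℕ.+ m) R.+ r (1 ℕ.+ k))
          ≈⟨ R.*-congˡ (symmetric-sum (suc p) 1+p+1+k≡m) ⟩
        a R.* (s (1 ℕ.+ p) R.* r m)
          ≈⟨ R.*-assoc a _ _ ⟨
        (a R.* s (1 ℕ.+ p)) R.* r m
          ≈⟨ R.*-congʳ (s-rec p) ⟨
        (s (2 ℕ.+ p) R.+ s p) R.* r m
          ≈⟨ R.distribʳ (r m) _ _ ⟩
        s (2 ℕ.+ p) R.* r m R.+ s p R.* r m ∎)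
      where
      1+p+1+k≡m : suc p ℕ.+ suc k ≡ m
      1+p+1+k≡m = trans (cong suc (ℕ.+-suc p k)) 2+p+k≡m
      p+2+k≡m : p ℕ.+ suc (suc k) ≡ m
      p+2+k≡m = trans (ℕ.+-suc p (suc k)) 1+p+1+k≡m

open LucasRecurrence ℝ-commutativeRing
open GroupProperties (CommutativeRing.+-group ℝ-commutativeRing) using (x≈z//y)

-- With `k` a variable, `2 + k` reduces to successors while `k + 2` is stuck; the induction relies
-- on the former.
shift-indices : ∀ {a} (u : ℕ → ℝ) →
  (∀ k → u (k ℕ.+ 2) ≃ a * u (k ℕ.+ 1) - u k) → Recurrence a u
shift-indices {a} u rec k = -⇒+ {u (2 ℕ.+ k)} {a * u (1 ℕ.+ k)} {u k}
  (subst₂ (λ i j → u i ≃ a * u j - u k) (ℕ.+-comm k 2) (ℕ.+-comm k 1) (rec k))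

theorem5p2 : (r : ℕ → ℝ) →
    (∀ k → r (k ℕ.+ 2) ≃ r 1 * r (k ℕ.+ 1) - r k) →
    (s : ℕ → ℝ) →
    s 0 ≃ 2ℝ → s 1 ≃ r 1 →
    (∀ k → s (k ℕ.+ 2) ≃ s 1 * s (k ℕ.+ 1) - s k) →
    ∀ p k → r (k ℕ.+ 2 ℕ.* p) ≃ s p * r (k ℕ.+ p) - r k
theorem5p2 r r-rec s s₀ s₁ s-rec p k =
  x≈z//y (r (k ℕ.+ 2 ℕ.* p)) (r k) (s p * r (k ℕ.+ p))
    (subst (λ n → r n + r k ≃ s p * r (k ℕ.+ p)) (top-index p k)
      (symmetric-sum {r 1} {r} {s} (shift-indices {r 1} r r-rec) s-rec′ s₀′ s₁
        p (ℕ.+-comm p k)))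
  where
  top-index : ∀ p k → p ℕ.+ (k ℕ.+ p) ≡ k ℕ.+ 2 ℕ.* p
  top-index = solve-∀
  s₀′ : s 0 ≃ 1ℝ + 1ℝ
  -- Both sequences are constant, and `1ℚ + 1ℚ` evaluates to the rational 2.
  s₀′ = ≃-trans {s 0} {2ℝ} {1ℝ + 1ℝ} s₀ (pointwise {2ℝ} {1ℝ + 1ℝ} λ _ → refl)
  -- Both sequences must share one coefficient, so `s 1` is exchanged for `r 1`.
  s-rec′ : Recurrence (r 1) s
  s-rec′ k = ≃-trans {s (2 ℕ.+ k) + s k} {s 1 * s (1 ℕ.+ k)} {r 1 * s (1 ℕ.+ k)}
    (shift-indices {s 1} s s-rec k)
    (*-cong {s 1} {r 1} {s (1 ℕ.+ k)} {s (1 ℕ.+ k)} s₁ (≃-refl {s (1 ℕ.+ k)}))
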